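{- If $G$ is a graph on $n \geq 2$ vertices, then (i) $2 \leq \alpha_{ir}(G) + \alpha_{ir}(\bar{G}) \leq n$, (ii) $1 \leq \alpha_{ir}(G)\, \alpha_{ir}(\bar{G}) \leq \lfloor \frac{n}{2} \rfloor \lfloor \frac{n+1}{2} \rfloor$. Moreover, the bounds are sharp: for each of the lower and upper bounds in (i) and (ii), there exist graphs on at least $2$ vertices for which equality holds.
   Context: All graphs are finite, simple and undirected. $\bar{G}$ denotes the complement of $G$. An irregular independent set of $G$ is an independent set $A$ of $G$ such that any two distinct vertices in $A$ have different degrees in $G$; the irregular independence number $\alpha_{ir}(G)$ is the size of a largest irregular independent set of $G$. -}

module Defs where

open import Data.Bool using (if_then_else_)
open import Data.Fin using (Fin)
import Data.Fin.Properties as Fin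
open import Data.Fin.Subset using (Subset; _∈_; ∣_∣; ⊥)
open import Data.Fin.Subset.Properties using (_∈?_; anySubset?; ∉⊥; ∣⊥∣≡0; ∣p∣≤n)
open import Data.Nat using (ℕ; zero; suc; _≤_; _≟_; s≤s)
open import Data.Nat.Properties using (m≤n⇒m<n∨m≡n)
open import Data.Product using (∃; _×_; _,_)
open import Data.Sum using (inj₁; inj₂)
open import Data.Vec using (tabulate)
open import Level using (0ℓ)
open import Relation.Binary using (Rel; Symmetric; Irreflexive; Decidable)
open import Relation.Binary.PropositionalEquality using (_≡_; _≢_; refl; sym)
open import Relation.Nullary using (¬_; yes; no; does; contradiction)
open import Relation.Nullary.Decidable using (_×-dec_; _→-dec_; ¬?)
import Relation.Unary as U

record Graph (n : ℕ) : Set₁ where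
  field
    _~_      : Rel (Fin n) 0ℓ
    ~-sym    : Symmetric _~_
    ~-irrefl : Irreflexive _≡_ _~_
    _~?_     : Decidable _~_

  neighbours : Fin n → Subset n
  neighbours i = tabulate (λ j → does (i ~? j))

  degree : Fin n → ℕ
  degree i = ∣ neighbours i ∣

  Independent : Subset n → Set
  Independent A = ∀ i j → i ∈ A → j ∈ A → ¬ (i ~ j)

  DistinctDegrees : Subset n → Set
  DistinctDegrees A = ∀ i j → i ∈ A → j ∈ A → i ≢ j → degree i ≢ degree j

  IrregularIndependent : Subset n → Set
  IrregularIndependent A = Independent A × DistinctDegrees A

  irregularIndependent? : U.Decidable IrregularIndependent
  irregularIndependent? A =
    Fin.all? (λ i → Fin.all? λ j →
      (i ∈? A) →-dec (j ∈? A) →-dec ¬? (i ~? j))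
    ×-dec
    Fin.all? (λ i → Fin.all? λ j →
      (i ∈? A) →-dec (j ∈? A) →-dec ¬? (i Fin.≟ j) →-dec
        ¬? (degree i ≟ degree j))

  HasIrregularIndependentOfSize : ℕ → Set
  HasIrregularIndependentOfSize k = ∃ λ A → IrregularIndependent A × ∣ A ∣ ≡ k

  hasIrregularIndependentOfSize? : U.Decidable HasIrregularIndependentOfSize
  hasIrregularIndependentOfSize? k =
    anySubset? (λ A → irregularIndependent? A ×-dec (∣ A ∣ ≟ k))

complement : ∀ {n} → Graph n → Graph n
complement G = record
  { _~_      = λ i j → i ≢ j × ¬ (i ~ j)
  ; ~-sym    = λ (i≢j , i≁j) → (λ j≡i → i≢j (sym j≡i)) , (λ j~i → i≁j (~-sym j~i))
  ; ~-irrefl = λ i≡j (i≢j , _) → i≢j i≡j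
  ; _~?_     = λ i j → ¬? (i Fin.≟ j) ×-dec ¬? (i ~? j)
  }
  where open Graph G

-- The largest k ≤ b with P k; the value 0 is also the default when there is no
-- such k, which does not arise in αir because the empty set has size 0.
greatest : ∀ {P : ℕ → Set} → U.Decidable P → ℕ → ℕ
greatest P? zero    = zero
greatest P? (suc b) = if does (P? (suc b)) then suc b else greatest P? b

greatest-satisfies : ∀ {P : ℕ → Set} (P? : U.Decidable P) b → P 0 → P (greatest P? b)
greatest-satisfies P? zero    p₀ = p₀
greatest-satisfies P? (suc b) p₀ with P? (suc b)
... | yes p = p
... | no  _ = greatest-satisfies P? b p₀

greatest-upper : ∀ {P : ℕ → Set} (P? : U.Decidable P) b {k} → k ≤ b → P k → k ≤ greatest P? b
greatest-upper P? zero    k≤b p = k≤b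
greatest-upper P? (suc b) k≤b p with P? (suc b)
... | yes _ = k≤b
... | no ¬p with m≤n⇒m<n∨m≡n k≤b
...   | inj₁ (s≤s k≤b′) = greatest-upper P? b k≤b′ p
...   | inj₂ refl       = contradiction p ¬p

αir : ∀ {n} → Graph n → ℕ
αir {n} G = greatest (Graph.hasIrregularIndependentOfSize? G) n

-- The next two facts characterise αir G as the size of a largest irregular
-- independent set.
αir-attained : ∀ {n} (G : Graph n) →
  ∃ λ A → Graph.IrregularIndependent G A × ∣ A ∣ ≡ αir G
αir-attained {n} G = greatest-satisfies (Graph.hasIrregularIndependentOfSize? G) n
  (⊥ , ((λ _ _ i∈⊥ → contradiction i∈⊥ ∉⊥) , (λ _ _ i∈⊥ → contradiction i∈⊥ ∉⊥)) , ∣⊥∣≡0 n)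

αir-upper : ∀ {n} (G : Graph n) A → Graph.IrregularIndependent G A → ∣ A ∣ ≤ αir G
αir-upper {n} G A irr =
  greatest-upper (Graph.hasIrregularIndependentOfSize? G) n (∣p∣≤n A) (A , irr , refl)

{-# OPTIONS --safe #-}
-- Let A be an irregular independent set of G and B one of its complement, i.e. a
-- clique; they share at most one vertex, so |A| + |B| ≤ n unless they share a vertex
-- v and cover all vertices. In that case every u ∈ A has its neighbours in B \ {v},
-- so the degrees on A are distinct and below |B|, whence |A| ≤ |B|, and equality
-- forces an isolated vertex of G. The same holds with the roles of (G , A) and
-- (complement G , B) exchanged, so |A| = |B| and both G and its complement have an
-- isolated vertex, which is impossible for n ≥ 2. For n = 2 the lower and upper bounds
-- coincide, so any graph on two vertices attains all four.
module Submission where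

open import Defs
open import Data.Empty using (⊥)
open import Data.Fin using (Fin; zero; suc)
import Data.Fin.Properties as Fin
open import Data.Fin.Subset
  using (Subset; inside; outside; _∈_; _∉_; _⊆_; _⊂_; _-_; ∁; ⁅_⁆; ∣_∣)
open import Data.Fin.Subset.Properties
open import Data.Nat
  using (ℕ; zero; suc; _+_; _*_; _∸_; _≤_; _<_; _≟_; ⌊_/2⌋; ⌈_/2⌉; z≤n; s≤s; s≤s⁻¹)
open import Data.Nat.Properties
open import Data.Product using (_×_; ∃; _,_; proj₁; proj₂)
open import Data.Vec using ([]; _∷_; there)
open import Data.Vec.Properties using (lookup∘tabulate; []=⇒lookup; lookup⇒[]=)
open import Function using (_∘_)
open import Relation.Binary.PropositionalEquality
  using (_≡_; _≢_; refl; sym; trans; cong; subst; subst₂; module ≡-Reasoning)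
open import Relation.Nullary using (¬_; yes; no; contradiction)
open import Relation.Nullary.Decidable
  using (_×-dec_; ¬?; dec-true; decidable-stable)

private
  variable
    n : ℕ

x∉p-x : ∀ (p : Subset n) x → x ∉ p - x
x∉p-x (_ ∷ p) zero    ()
x∉p-x (_ ∷ p) (suc x) (there x∈p-x) = x∉p-x p x x∈p-x

∣p∣≤1+∣p-x∣ : ∀ (p : Subset n) x → ∣ p ∣ ≤ suc ∣ p - x ∣
∣p∣≤1+∣p-x∣ (outside ∷ p) zero    =
  m≤n⇒m≤1+n (p⊆q⇒∣p∣≤∣q∣ (λ x∈p → subst (_ ∈_) (sym (p─⊥≡p p)) x∈p))
∣p∣≤1+∣p-x∣ (inside ∷ p)  zero    =
  s≤s (p⊆q⇒∣p∣≤∣q∣ (λ x∈p → subst (_ ∈_) (sym (p─⊥≡p p)) x∈p))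
∣p∣≤1+∣p-x∣ (outside ∷ p) (suc x) = ∣p∣≤1+∣p-x∣ p x
∣p∣≤1+∣p-x∣ (inside ∷ p)  (suc x) = s≤s (∣p∣≤1+∣p-x∣ p x)

x∈p⇒0<∣p∣ : ∀ {p : Subset n} {x} → x ∈ p → 0 < ∣ p ∣
x∈p⇒0<∣p∣ x∈p = ≤-<-trans z≤n (x∈p⇒∣p-x∣<∣p∣ x∈p)

∣p∣+∣∁p∣≡n : ∀ (p : Subset n) → ∣ p ∣ + ∣ ∁ p ∣ ≡ n
∣p∣+∣∁p∣≡n p = trans (cong (∣ p ∣ +_) (∣∁p∣≡n∸∣p∣ p)) (m+[n∸m]≡n (∣p∣≤n p))

-- Pigeonhole by induction on `m`: by injectivity at most one element of `p` takes the top value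
-- `m + lo`, and without it the values fit into an interval shorter by one. It is used with `lo`
-- equal to 0 to bound an irregular set, and to 1 when no degree on the set vanishes.
injective-into-interval : ∀ (f : Fin n → ℕ) lo m (p : Subset n) →
  (∀ i j → i ∈ p → j ∈ p → i ≢ j → f i ≢ f j) →
  (∀ i → i ∈ p → lo ≤ f i) → (∀ i → i ∈ p → f i < m + lo) → ∣ p ∣ ≤ m
injective-into-interval {n} f lo zero p inj lower upper with nonempty? p
... | yes (i , i∈p) = contradiction (lower i i∈p) (<⇒≱ (upper i i∈p))
... | no empty      = ≤-reflexive (trans (cong ∣_∣ (Empty-unique empty)) (∣⊥∣≡0 n))
injective-into-interval f lo (suc m) p inj lower upper
  with Fin.any? (λ i → (i ∈? p) ×-dec (f i ≟ m + lo))
... | no ¬top =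
  m≤n⇒m≤1+n (injective-into-interval f lo m p inj lower
    (λ i i∈p → ≤∧≢⇒< (s≤s⁻¹ (upper i i∈p)) (λ fi≡top → ¬top (i , i∈p , fi≡top))))
... | yes (x , x∈p , fx≡top) =
  ≤-trans (∣p∣≤1+∣p-x∣ p x) (s≤s (injective-into-interval f lo m (p - x)
    (λ i j i∈ j∈ → inj i j (p-x⊆p i∈) (p-x⊆p j∈))
    (λ i i∈ → lower i (p-x⊆p i∈))
    (λ i i∈ → ≤∧≢⇒< (s≤s⁻¹ (upper i (p-x⊆p i∈)))
      (λ fi≡top → inj i x (p-x⊆p i∈) x∈p
        (λ { refl → x∉p-x p x i∈ }) (trans fi≡top (sym fx≡top))))))
  where
  p-x⊆p : p - x ⊆ p
  p-x⊆p = p─q⊆p p ⁅ x ⁆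

module _ (G : Graph n) where
  open Graph G

  ∈-neighbours⁻ : ∀ {i j} → j ∈ neighbours i → i ~ j
  ∈-neighbours⁻ {i} {j} j∈ with i ~? j | trans (sym (lookup∘tabulate _ j)) ([]=⇒lookup j∈)
  ... | yes i~j | _ = i~j
  ... | no _    | ()

  ∈-neighbours⁺ : ∀ {i j} → i ~ j → j ∈ neighbours i
  ∈-neighbours⁺ {i} {j} i~j =
    lookup⇒[]= j _ (trans (lookup∘tabulate _ j) (dec-true (i ~? j) i~j))

  degree≡0⇒≁ : ∀ {i} → degree i ≡ 0 → ∀ j → ¬ (i ~ j)
  degree≡0⇒≁ deg≡0 j i~j = <⇒≢ (x∈p⇒0<∣p∣ (∈-neighbours⁺ i~j)) (sym deg≡0)

  singleton-irregularIndependent : ∀ v → IrregularIndependent ⁅ v ⁆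
  singleton-irregularIndependent v =
    (λ i j i∈ j∈ → ~-irrefl (equal i∈ j∈)) ,
    (λ i j i∈ j∈ i≢j → contradiction (equal i∈ j∈) i≢j)
    where
    equal : ∀ {i j} → i ∈ ⁅ v ⁆ → j ∈ ⁅ v ⁆ → i ≡ j
    equal i∈ j∈ = trans (x∈⁅y⁆⇒x≡y v i∈) (sym (x∈⁅y⁆⇒x≡y v j∈))

  module _ {A B : Subset n} (irr : IrregularIndependent A) (∁A⊆B : ∀ {i} → i ∉ A → i ∈ B)
           {v : Fin n} (v∈A : v ∈ A) (v∈B : v ∈ B) where

    -- By independence, all neighbours of a vertex of `A` lie outside `A`, hence in `B`. The
    -- inclusion is strict because `v`, itself in `A`, is not among them.
    degree<cover : ∀ i → i ∈ A → degree i < ∣ B ∣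
    degree<cover i i∈A = p⊂q⇒∣p∣<∣q∣
      ( (λ j∈ → ∁A⊆B (λ j∈A → proj₁ irr i _ i∈A j∈A (∈-neighbours⁻ j∈)))
      , v , v∈B , (λ v∈ → proj₁ irr i v i∈A v∈A (∈-neighbours⁻ v∈)) )

    irregular≤cover : ∣ A ∣ ≤ ∣ B ∣
    irregular≤cover = injective-into-interval degree 0 ∣ B ∣ A (proj₂ irr) (λ _ _ → z≤n)
      (λ i i∈A → subst (degree i <_) (sym (+-identityʳ ∣ B ∣)) (degree<cover i i∈A))

    -- If no vertex of `A` had degree 0, the distinct degrees on `A` would lie between 1 and
    -- `∣ B ∣ ∸ 1`, leaving room for fewer than `∣ B ∣` vertices.
    isolated-vertex : ∣ B ∣ ≤ ∣ A ∣ → ∃ λ u → ∀ j → ¬ (u ~ j)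
    isolated-vertex B≤A with Fin.any? (λ i → (i ∈? A) ×-dec (degree i ≟ 0))
    ... | yes (u , _ , deg≡0) = u , degree≡0⇒≁ deg≡0
    ... | no ¬isolated = contradiction B≤A (<⇒≱ A<B)
      where
      -- The truncated subtraction is exact, since `v` makes `B` nonempty.
      m+1≡∣B∣ : ∣ B ∣ ∸ 1 + 1 ≡ ∣ B ∣
      m+1≡∣B∣ = m∸n+n≡m (x∈p⇒0<∣p∣ v∈B)

      A<B : ∣ A ∣ < ∣ B ∣
      A<B = subst (∣ A ∣ <_) (trans (+-comm 1 _) m+1≡∣B∣)
        (s≤s (injective-into-interval degree 1 (∣ B ∣ ∸ 1) A (proj₂ irr)
          (λ i i∈A → n≢0⇒n>0 (λ deg≡0 → ¬isolated (i , i∈A , deg≡0)))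
          (λ i i∈A → subst (degree i <_) (sym m+1≡∣B∣) (degree<cover i i∈A))))

∃-distinct : 2 ≤ n → (i : Fin n) → ∃ λ j → i ≢ j
∃-distinct (s≤s (s≤s _)) zero    = suc zero , λ ()
∃-distinct (s≤s (s≤s _)) (suc i) = zero , λ ()

-- A vertex isolated in the complement is adjacent in `G` to every other vertex. If `u` and `w`
-- differ, this makes `w` adjacent to the isolated `u`; if they coincide, any second vertex gives
-- the contradiction.
¬both-isolated : 2 ≤ n → (G : Graph n) → let open Graph G in
  ∀ u w → (∀ j → ¬ (u ~ j)) → ¬ (∀ j → ¬ Graph._~_ (complement G) w j)
¬both-isolated 2≤n G u w u-isolated w-dominating with u Fin.≟ w
... | yes refl with (x , u≢x) ← ∃-distinct 2≤n u = w-dominating x (u≢x , u-isolated x)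
... | no u≢w = w-dominating u (u≢w ∘ sym , u-isolated w ∘ Graph.~-sym G)

irregular-sum≤n : 2 ≤ n → (G : Graph n) → ∀ {A B} →
  Graph.IrregularIndependent G A → Graph.IrregularIndependent (complement G) B →
  ∣ A ∣ + ∣ B ∣ ≤ n
irregular-sum≤n {n} 2≤n G {A} {B} irrA irrB
  with Fin.any? (λ v → (v ∈? A) ×-dec (v ∈? B))
... | no disjoint = subst (∣ A ∣ + ∣ B ∣ ≤_) (∣p∣+∣∁p∣≡n A)
  (+-monoʳ-≤ ∣ A ∣ (p⊆q⇒∣p∣≤∣q∣ (λ i∈B → x∉p⇒x∈∁p (λ i∈A → disjoint (_ , i∈A , i∈B)))))
... | yes (v , v∈A , v∈B) with Fin.any? (λ x → ¬? (x ∈? A) ×-dec ¬? (x ∈? B))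
-- Removing the shared vertex `v` costs `B` one element. The vertex `x`, missed by both sets, makes
-- up for it, as the rest of `B` lies strictly inside `∁ A`.
...   | yes (x , x∉A , x∉B) = subst (∣ A ∣ + ∣ B ∣ ≤_) (∣p∣+∣∁p∣≡n A)
  (+-monoʳ-≤ ∣ A ∣ (≤-trans (∣p∣≤1+∣p-x∣ B v) (p⊂q⇒∣p∣<∣q∣ B-v⊂∁A)))
  where
  open Graph G

  common≡v : ∀ {i} → i ∈ A → i ∈ B → i ≡ v
  common≡v {i} i∈A i∈B = decidable-stable (i Fin.≟ v)
    -- Two distinct common vertices would be non-adjacent in `G`, both lying in `A`, and hence
    -- adjacent in the complement, where `B` is independent.
    (λ i≢v → proj₁ irrB i v i∈B v∈B (i≢v , proj₁ irrA i v i∈A v∈A))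

  B-v⊂∁A : B - v ⊂ ∁ A
  B-v⊂∁A =
    (λ i∈B-v → x∉p⇒x∈∁p (λ i∈A → x∉p-x B v
      (subst (_∈ B - v) (common≡v i∈A (p─q⊆p B ⁅ v ⁆ i∈B-v)) i∈B-v))) ,
    x , x∉p⇒x∈∁p x∉A , x∉B ∘ p─q⊆p B ⁅ v ⁆
...   | no covering = contradiction
  (proj₂ (isolated-vertex (complement G) irrB ∁B⊆A v∈B v∈A A≤B))
  (¬both-isolated 2≤n G _ _ (proj₂ (isolated-vertex G irrA ∁A⊆B v∈A v∈B B≤A)))
  where
  ∁A⊆B : ∀ {i} → i ∉ A → i ∈ B
  ∁A⊆B {i} i∉A = decidable-stable (i ∈? B) (λ i∉B → covering (i , i∉A , i∉B))

  ∁B⊆A : ∀ {i} → i ∉ B → i ∈ A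
  ∁B⊆A {i} i∉B = decidable-stable (i ∈? A) (λ i∉A → covering (i , i∉A , i∉B))

  A≤B : ∣ A ∣ ≤ ∣ B ∣
  A≤B = irregular≤cover G irrA ∁A⊆B v∈A v∈B

  B≤A : ∣ B ∣ ≤ ∣ A ∣
  B≤A = irregular≤cover (complement G) irrB ∁B⊆A v∈B v∈A

αir-sum≤n : 2 ≤ n → (G : Graph n) → αir G + αir (complement G) ≤ n
αir-sum≤n {n} 2≤n G =
  let A , irrA , ∣A∣≡α = αir-attained G
      B , irrB , ∣B∣≡ᾱ = αir-attained (complement G)
  in subst₂ (λ a b → a + b ≤ n) ∣A∣≡α ∣B∣≡ᾱ (irregular-sum≤n 2≤n G irrA irrB)

1≤αir : (G : Graph (suc n)) → 1 ≤ αir G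
1≤αir {n} G = subst (_≤ αir G) (∣⁅x⁆∣≡1 (zero {n}))
  (αir-upper G ⁅ zero ⁆ (singleton-irregularIndependent G zero))

1+m*1+n : ∀ m n → suc m * suc n ≡ suc (m + n + m * n)
1+m*1+n m n = cong suc (begin
  n + m * suc n    ≡⟨ cong (n +_) (*-suc m n) ⟩
  n + (m + m * n)  ≡⟨ sym (+-assoc n m (m * n)) ⟩
  n + m + m * n    ≡⟨ cong (_+ m * n) (+-comm n m) ⟩
  m + n + m * n    ∎)
  where open ≡-Reasoning

-- Induction lowering both factors by one, which lowers each half of the sum by one. By `1+m*1+n`,
-- both products then drop by one plus the sum of the lowered factors, and that sum is `m + n` on
-- either side.
m*n≤⌊m+n/2⌋*⌈m+n/2⌉ : ∀ m n → m * n ≤ ⌊ m + n /2⌋ * ⌈ m + n /2⌉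
m*n≤⌊m+n/2⌋*⌈m+n/2⌉ zero    n       = z≤n
m*n≤⌊m+n/2⌋*⌈m+n/2⌉ (suc m) zero    = ≤-trans (≤-reflexive (*-zeroʳ m)) z≤n
m*n≤⌊m+n/2⌋*⌈m+n/2⌉ (suc m) (suc n) rewrite +-suc m n = begin
  suc m * suc n          ≡⟨ 1+m*1+n m n ⟩
  suc (m + n + m * n)    ≤⟨ s≤s (+-monoʳ-≤ (m + n) (m*n≤⌊m+n/2⌋*⌈m+n/2⌉ m n)) ⟩
  suc (m + n + p * q)    ≡⟨ cong (λ s → suc (s + p * q)) (sym (⌊n/2⌋+⌈n/2⌉≡n (m + n))) ⟩
  suc (p + q + p * q)    ≡⟨ sym (1+m*1+n p q) ⟩
  suc p * suc q          ∎
  where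
  open ≤-Reasoning
  p = ⌊ m + n /2⌋
  q = ⌈ m + n /2⌉

m+n≤o⇒m*n≤⌊o/2⌋*⌊o+1/2⌋ : ∀ m n {o} → m + n ≤ o → m * n ≤ ⌊ o /2⌋ * ⌊ o + 1 /2⌋
m+n≤o⇒m*n≤⌊o/2⌋*⌊o+1/2⌋ m n {o} m+n≤o rewrite +-comm o 1 =
  -- By definition `⌈ k /2⌉` is `⌊ suc k /2⌋`, so monotonicity of the floor bounds both factors.
  ≤-trans (m*n≤⌊m+n/2⌋*⌈m+n/2⌉ m n) (*-mono-≤ (⌊n/2⌋-mono m+n≤o) (⌊n/2⌋-mono (s≤s m+n≤o)))

edgeless₂ : Graph 2
edgeless₂ = record
  { _~_      = λ _ _ → ⊥
  ; ~-sym    = λ ()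
  ; ~-irrefl = λ _ ()
  ; _~?_     = λ _ _ → no λ ()
  }

theorem6p1 : ( (n : ℕ) → 2 ≤ n → (G : Graph n) →
    (2 ≤ αir G + αir (complement G) × αir G + αir (complement G) ≤ n)
    × (1 ≤ αir G * αir (complement G) × αir G * αir (complement G) ≤ ⌊ n /2⌋ * ⌊ n + 1 /2⌋) )
    × (∃ λ (n : ℕ) → 2 ≤ n × ∃ λ (G : Graph n) → αir G + αir (complement G) ≡ 2)
    × (∃ λ (n : ℕ) → 2 ≤ n × ∃ λ (G : Graph n) → αir G + αir (complement G) ≡ n)
    × (∃ λ (n : ℕ) → 2 ≤ n × ∃ λ (G : Graph n) → αir G * αir (complement G) ≡ 1)
    × (∃ λ (n : ℕ) → 2 ≤ n × ∃ λ (G : Graph n) → αir G * αir (complement G) ≡ ⌊ n /2⌋ * ⌊ n + 1 /2⌋)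
theorem6p1 =
    (λ { (suc n) 2≤n G →
      let sum≤n = αir-sum≤n 2≤n G
          1≤α   = 1≤αir G
          1≤ᾱ   = 1≤αir (complement G)
      in (+-mono-≤ 1≤α 1≤ᾱ , sum≤n) ,
         (*-mono-≤ 1≤α 1≤ᾱ ,
          m+n≤o⇒m*n≤⌊o/2⌋*⌊o+1/2⌋ (αir G) (αir (complement G)) sum≤n) })
  -- Here `αir` evaluates to 1 for the graph and for its complement, since the two vertices have
  -- equal degrees in each. The sum is thus 2, which is also `n`, and the product is 1, as is the
  -- upper bound.
  , (2 , ≤-refl , edgeless₂ , refl)
  , (2 , ≤-refl , edgeless₂ , refl)
  , (2 , ≤-refl , edgeless₂ , refl)
  , (2 , ≤-refl , edgeless₂ , refl)
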